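{- Let $k\ge 1$ and let $\mathcal{H}_k=(V_k,\mathcal{E}_k)$ be a $k$-uniform hypergraph that has no proper $2$-coloring. Let $D_k$ be the directed graph with vertex set $V_k\cup U_k\cup\{s\}$, where $U_k=\{u_E: E\in\mathcal{E}_k\}$ is a set of new vertices, one for each hyperedge, and $s$ is a new vertex, and whose arcs are $sv$ for every $v\in V_k$ and $vu_E$ for every $v\in V_k$ and $E\in\mathcal{E}_k$ with $v\in E$. Then $D_k$ is acyclic, every $u\in U_k$ satisfies $\lambda_{D_k}(s,u)=k$, and $D_k$ contains no two arc-disjoint $(s,U_k)$-arborescences.
   Context: A hypergraph $(V,\mathcal{E})$ is $k$-uniform if every hyperedge has exactly $k$ vertices; a $2$-coloring of $V$ is proper if no hyperedge is monochromatic. $\lambda_D(s,v)$ is the maximum number of arc-disjoint directed $(s,v)$-paths in $D$. An $s$-arborescence is an acyclic subgraph $F=(V'\cup\{s\},A')$ in which every vertex of $V'$ has in-degree exactly $1$; it is an $(s,U)$-arborescence if it contains all vertices of $U$. -}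

module Defs where

open import Level using (0ℓ)
open import Data.Nat using (ℕ; _≤_)
open import Data.Fin using (Fin)
open import Data.Fin.Subset using (Subset; ∣_∣) renaming (_∈_ to _∈ˢ_)
open import Data.List using (List; []; _∷_; length)
open import Data.List.Membership.Propositional using () renaming (_∈_ to _∈ˡ_)
open import Data.List.Relation.Unary.Unique.Propositional using (Unique)
open import Data.List.Relation.Binary.Disjoint.Propositional using (Disjoint)
open import Data.Product using (Σ; ∃; ∃₂; _×_; _,_; proj₁)
open import Function.Bundles using (_⇔_)
open import Function.Definitions using (Injective)
open import Relation.Binary.Core using (Rel; _⇒_)
open import Relation.Binary.Construct.Closure.ReflexiveTransitive using (Star; ε; _◅_)
open import Relation.Binary.PropositionalEquality using (_≡_; _≢_)
open import Relation.Nullary using (¬_)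
open import Relation.Unary using (Pred; _∈_; _⊆_)

-- Injectivity makes the hyperedges a set rather than a multiset, so Fin size
-- can serve as the index set of the hyperedges.
record Hypergraph : Set where
  field
    order          : ℕ
    size           : ℕ
    edge           : Fin size → Subset order
    edge-injective : Injective _≡_ _≡_ edge

open Hypergraph public

Uniform : ℕ → Hypergraph → Set
Uniform k H = ∀ e → ∣ edge H e ∣ ≡ k

TwoColoring : Hypergraph → Set
TwoColoring H = Fin (order H) → Fin 2

Monochromatic : (H : Hypergraph) → TwoColoring H → Fin (size H) → Set
Monochromatic H c e = ∃ λ colour → ∀ v → v ∈ˢ edge H e → c v ≡ colour

Proper : (H : Hypergraph) → TwoColoring H → Set
Proper H c = ∀ e → ¬ Monochromatic H c e

-- Arcs are identified with ordered pairs of vertices: there are no parallel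
-- arcs, and different proofs of D x y stand for the same arc.
Digraph : Set → Set₁
Digraph V = Rel V 0ℓ

module _ {V : Set} where

  walkVertices : {D : Digraph V} {x y : V} → Star D x y → List V
  walkVertices {x = x} ε       = x ∷ []
  walkVertices {x = x} (_ ◅ w) = x ∷ walkVertices w

  walkArcs : {D : Digraph V} {x y : V} → Star D x y → List (V × V)
  walkArcs ε                         = []
  walkArcs {x = x} (_◅_ {j = z} _ w) = (x , z) ∷ walkArcs w

  Path : Digraph V → V → V → Set
  Path D x y = Σ (Star D x y) λ w → Unique (walkVertices w)

  pathArcs : {D : Digraph V} {x y : V} → Path D x y → List (V × V)
  pathArcs p = walkArcs (proj₁ p)

  -- A directed cycle is a path from y to x closed up by an arc xy; a loop is
  -- the case x ≡ y.
  Cycle : Digraph V → Set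
  Cycle D = ∃₂ λ x y → D x y × Path D y x

  Acyclic : Digraph V → Set
  Acyclic D = ¬ Cycle D

  ArcDisjointPaths : Digraph V → V → V → ℕ → Set
  ArcDisjointPaths D x y m =
    Σ (Fin m → Path D x y) λ P →
      ∀ i j → i ≢ j → Disjoint (pathArcs (P i)) (pathArcs (P j))

  -- The equation λ_D(x,y) = k.
  λ[_]⟨_,_⟩≡_ : Digraph V → V → V → ℕ → Set
  λ[ D ]⟨ x , y ⟩≡ k =
    ArcDisjointPaths D x y k × (∀ m → ArcDisjointPaths D x y m → m ≤ k)

  InDegree : Digraph V → V → ℕ → Set
  InDegree D y d =
    ∃ λ (xs : List V) → Unique xs × (∀ x → (x ∈ˡ xs) ⇔ D x y) × length xs ≡ d

  record Subgraph (D : Digraph V) : Set₁ where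
    field
      vertices : Pred V 0ℓ
      arcs     : Digraph V
      arcs⊆    : arcs ⇒ D
      tail∈    : ∀ {x y} → arcs x y → x ∈ vertices
      head∈    : ∀ {x y} → arcs x y → y ∈ vertices

  open Subgraph public

  -- In the vertex set V' ∪ {s}, V' is taken not to contain s.
  record IsArborescence {D : Digraph V} (s : V) (F : Subgraph D) : Set where
    field
      root∈     : s ∈ vertices F
      acyclic   : Acyclic (arcs F)
      inDegree1 : ∀ x → x ∈ vertices F → x ≢ s → InDegree (arcs F) x 1

  IsArborescenceOn : {D : Digraph V} → V → Pred V 0ℓ → Subgraph D → Set
  IsArborescenceOn s U F = IsArborescence s F × U ⊆ vertices F

  ArcDisjoint : {D : Digraph V} → Subgraph D → Subgraph D → Set
  ArcDisjoint F G = ∀ x y → ¬ (arcs F x y × arcs G x y)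

data Vertex (H : Hypergraph) : Set where
  s : Vertex H
  v : Fin (order H) → Vertex H
  u : Fin (size H) → Vertex H

data D[_] (H : Hypergraph) : Digraph (Vertex H) where
  sv : ∀ x → D[ H ] s (v x)
  vu : ∀ x e → x ∈ˢ edge H e → D[ H ] (v x) (u e)

U[_] : (H : Hypergraph) → Pred (Vertex H) 0ℓ
U[ H ] x = ∃ λ e → x ≡ u e

{-# OPTIONS --safe #-}
-- An (s,U)-arborescence picks for every hyperedge E one vertex of E as the tail
-- of its arc into u_E, and must contain the arc from s to every vertex picked.
-- Hence two arc-disjoint arborescences pick disjoint sets of vertices, each
-- meeting every hyperedge, and colouring by membership in the first set is
-- proper.  For the connectivity, a path from s to u_E has the form s, v, u_E
-- with v ∈ E, and it is determined by its first arc.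
module Submission where

open import Data.Bool using (if_then_else_)
open import Data.Fin using (Fin; zero; suc)
open import Data.Fin.Properties using (any?; injective⇒≤; suc-injective; _≟_)
open import Data.Fin.Subset using (Subset; ∣_∣; inside; outside) renaming (_∈_ to _∈ˢ_)
open import Data.List using ([]; _∷_)
open import Data.List.Membership.Propositional using () renaming (_∈_ to _∈ˡ_)
open import Data.List.Relation.Binary.Disjoint.Propositional using (Disjoint)
open import Data.List.Relation.Unary.All using ([]; _∷_)
open import Data.List.Relation.Unary.AllPairs using ([]; _∷_)
open import Data.List.Relation.Unary.Any using (here; there)
open import Data.Nat using (ℕ; _≤_; _<_; z≤n; s≤s)
open import Data.Nat.Properties using (≤-refl; ≤-trans; <⇒≤; <⇒≱)
open import Data.Product using (∃; ∃₂; _×_; _,_; proj₁; proj₂)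
open import Data.Vec using (_∷_; here; there)
open import Function.Bundles using (Equivalence)
open import Function.Definitions using (Injective)
open import Relation.Binary.Construct.Closure.ReflexiveTransitive using (Star; ε; _◅_)
open import Relation.Binary.PropositionalEquality using (_≡_; _≢_; refl; sym; trans; cong; subst)
open import Relation.Nullary using (¬_; Dec; does)
open import Relation.Nullary.Decidable using (decidable-stable; dec-true; dec-false)
open import Relation.Unary using (_∈_)
open import Defs

-- Enumerates the members in increasing order, so that `Fin ∣ edge H e ∣` can index the paths to
-- `u e`.
nth : ∀ {n} (p : Subset n) → Fin ∣ p ∣ → Fin n
nth (inside  ∷ p) zero    = zero
nth (inside  ∷ p) (suc i) = suc (nth p i)
nth (outside ∷ p) i       = suc (nth p i)

nth-∈ : ∀ {n} (p : Subset n) i → nth p i ∈ˢ p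
nth-∈ (inside  ∷ p) zero    = here
nth-∈ (inside  ∷ p) (suc i) = there (nth-∈ p i)
nth-∈ (outside ∷ p) i       = there (nth-∈ p i)

nth-injective : ∀ {n} (p : Subset n) → Injective _≡_ _≡_ (nth p)
nth-injective (inside  ∷ p) {zero}  {zero}  eq = refl
nth-injective (inside  ∷ p) {suc i} {suc j} eq = cong suc (nth-injective p (suc-injective eq))
nth-injective (outside ∷ p)                 eq = nth-injective p (suc-injective eq)

-- Counts the members below `x`. Recursion on the membership proof keeps the value under `∣ p ∣`.
rank : ∀ {n} {p : Subset n} {x} → x ∈ˢ p → Fin ∣ p ∣
rank                   here      = zero
rank {p = inside  ∷ _} (there m) = suc (rank m)
rank {p = outside ∷ _} (there m) = rank m

rank-injective : ∀ {n} {p : Subset n} {x y} (a : x ∈ˢ p) (b : y ∈ˢ p) → rank a ≡ rank b → x ≡ y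
rank-injective                   here      here      eq = refl
rank-injective {p = inside  ∷ _} (there a) (there b) eq = cong suc (rank-injective a b (suc-injective eq))
rank-injective {p = outside ∷ _} (there a) (there b) eq = cong suc (rank-injective a b eq)

-- Composing `f` with `rank` gives an injection of `Fin m` into `Fin ∣ p ∣`.
injection-into⇒≤ : ∀ {m n} (p : Subset n) (f : Fin m → Fin n) →
  (∀ i → f i ∈ˢ p) → Injective _≡_ _≡_ f → m ≤ ∣ p ∣
injection-into⇒≤ p f f∈p f-inj =
  injective⇒≤ {f = λ i → rank (f∈p i)} (λ {i} {j} eq → f-inj (rank-injective (f∈p i) (f∈p j) eq))

module _ {V : Set} {D : Digraph V} (height : V → ℕ)
         (height-< : ∀ {x y} → D x y → height x < height y) where

  height-≤ : ∀ {x y} → Star D x y → height x ≤ height y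
  height-≤ ε       = ≤-refl
  height-≤ (a ◅ w) = ≤-trans (<⇒≤ (height-< a)) (height-≤ w)

  -- The closing arc strictly raises the height, while the path back cannot lower it.
  increasing⇒acyclic : Acyclic D
  increasing⇒acyclic (x , y , a , w , _) = <⇒≱ (height-< a) (height-≤ w)

inNeighbour : ∀ {V : Set} {D : Digraph V} {y} → InDegree D y 1 → ∃ λ x → D x y
inNeighbour (x ∷ [] , _ , x∈⇔ , refl) = x , Equivalence.to (x∈⇔ x) (here refl)

module _ (H : Hypergraph) where

  level : Vertex H → ℕ
  level s     = 0
  level (v _) = 1
  level (u _) = 2

  level-< : ∀ {x y} → D[ H ] x y → level x < level y
  level-< (sv _)     = s≤s z≤n
  level-< (vu _ _ _) = s≤s (s≤s z≤n)

  acyclic-D : Acyclic D[ H ]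
  acyclic-D = increasing⇒acyclic level level-<

  path-via : ∀ {e x} → x ∈ˢ edge H e → Path D[ H ] s (u e)
  path-via x∈e = sv _ ◅ vu _ _ x∈e ◅ ε ,
    ((λ ()) ∷ (λ ()) ∷ []) ∷ ((λ ()) ∷ []) ∷ [] ∷ []

  -- Each arc of such a path has the inner vertex as an end, so a shared arc forces equal inner
  -- vertices.
  path-via-disjoint : ∀ {e x y} (x∈e : x ∈ˢ edge H e) (y∈e : y ∈ˢ edge H e) → x ≢ y →
    Disjoint (pathArcs (path-via x∈e)) (pathArcs (path-via y∈e))
  path-via-disjoint _ _ x≢y (here refl         , here refl)         = x≢y refl
  path-via-disjoint _ _ x≢y (here refl         , there (here ()))
  path-via-disjoint _ _ x≢y (there (here refl) , here ())
  path-via-disjoint _ _ x≢y (there (here refl) , there (here refl)) = x≢y refl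

  -- One clause suffices: arcs from `s` lead only to some `v x`, arcs from there only to some `u e`,
  -- and no arc leaves `u e`.
  first-arc : ∀ {e} (w : Star D[ H ] s (u e)) →
    ∃ λ x → x ∈ˢ edge H e × (s , v x) ∈ˡ walkArcs w
  first-arc (sv x ◅ vu .x _ x∈e ◅ ε) = x , x∈e , here refl

  connectivity : ∀ e → λ[ D[ H ] ]⟨ s , u e ⟩≡ ∣ edge H e ∣
  connectivity e = (P , P-disjoint) , bound
    where
    p = edge H e

    P : Fin ∣ p ∣ → Path D[ H ] s (u e)
    P i = path-via (nth-∈ p i)

    P-disjoint : ∀ i j → i ≢ j → Disjoint (pathArcs (P i)) (pathArcs (P j))
    P-disjoint i j i≢j =
      path-via-disjoint (nth-∈ p i) (nth-∈ p j) (λ eq → i≢j (nth-injective p eq))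

    bound : ∀ m → ArcDisjointPaths D[ H ] s (u e) m → m ≤ ∣ p ∣
    bound m (Q , Q-disjoint) = injection-into⇒≤ p mid (λ i → proj₁ (proj₂ (first i))) mid-injective
      where
      first : ∀ i → ∃ λ x → x ∈ˢ p × (s , v x) ∈ˡ pathArcs (Q i)
      first i = first-arc (proj₁ (Q i))

      mid : Fin m → Fin (order H)
      mid i = proj₁ (first i)

      first∈ : ∀ i → (s , v (mid i)) ∈ˡ pathArcs (Q i)
      first∈ i = proj₂ (proj₂ (first i))

      mid-injective : Injective _≡_ _≡_ mid
      -- Disjointness is available only for distinct indices, hence the indirect argument: two paths
      -- with the same inner vertex would share its arc from `s`.
      mid-injective {i} {j} eq = decidable-stable (i ≟ j) λ i≢j →
        Q-disjoint i j i≢j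
          (first∈ i , subst (λ x → (s , v x) ∈ˡ pathArcs (Q j)) (sym eq) (first∈ j))

  module _ {F : Subgraph D[ H ]} (arb : IsArborescenceOn s U[ H ] F) where
    open IsArborescence (proj₁ arb) using (inDegree1)

    tail-arc : ∀ e → ∃ λ x → arcs F (v x) (u e)
    tail-arc e with inNeighbour {D = arcs F} (inDegree1 (u e) (proj₂ arb (e , refl)) (λ ()))
    ... | z , a with arcs⊆ F {z} a
    -- Only `vu` arcs enter `u e`, which identifies the tail `z`.
    ... | vu x _ _ = x , a

    pick : Fin (size H) → Fin (order H)
    pick e = proj₁ (tail-arc e)

    pick∈edge : ∀ e → pick e ∈ˢ edge H e
    pick∈edge e with arcs⊆ F (proj₂ (tail-arc e))
    ... | vu _ _ x∈e = x∈e

    -- The picked vertex lies in `F` as the tail of an arc of `F`, so it has an in-arc there, and in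
    -- `D[ H ]` only `s` can be its source.
    pick-root-arc : ∀ e → arcs F s (v (pick e))
    pick-root-arc e with inNeighbour {D = arcs F} (inDegree1 (v (pick e)) (tail∈ F (proj₂ (tail-arc e))) (λ ()))
    ... | z , a with arcs⊆ F {z} a
    ... | sv _ = a

  disjoint-transversals⇒colourable : (f g : Fin (size H) → Fin (order H)) →
    (∀ e → f e ∈ˢ edge H e) → (∀ e → g e ∈ˢ edge H e) → (∀ e e′ → f e ≢ g e′) →
    ∃ λ c → Proper H c
  disjoint-transversals⇒colourable f g f∈ g∈ f≢g = c , proper
    where
    -- A finite search decides membership in the image of `f`, so the colouring is a genuine
    -- function.
    picked? : ∀ x → Dec (∃ λ e → f e ≡ x)
    picked? x = any? (λ e → f e ≟ x)

    c : TwoColoring H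
    c x = if does (picked? x) then zero else suc zero

    c-f : ∀ e → c (f e) ≡ zero
    c-f e = cong (if_then zero else suc zero) (dec-true (picked? (f e)) (e , refl))

    c-g : ∀ e → c (g e) ≡ suc zero
    c-g e = cong (if_then zero else suc zero)
      (dec-false (picked? (g e)) (λ (e′ , eq) → f≢g e′ e eq))

    proper : Proper H c
    proper e (colour , mono)
      -- A single colour on the hyperedge would equate the colours of `f e` and `g e`, that is,
      -- `zero` and `suc zero`.
      with () ← trans (sym (c-f e)) (trans (mono (f e) (f∈ e)) (trans (sym (mono (g e) (g∈ e))) (c-g e)))

  disjoint-arborescences⇒colourable : {F G : Subgraph D[ H ]} →
    IsArborescenceOn s U[ H ] F → IsArborescenceOn s U[ H ] G → ArcDisjoint F G →
    ∃ λ c → Proper H c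
  disjoint-arborescences⇒colourable {F} {G} arbF arbG F∩G=∅ =
    disjoint-transversals⇒colourable (pick arbF) (pick arbG) (pick∈edge arbF) (pick∈edge arbG)
      -- A vertex picked by both, even for different hyperedges, would put its arc from `s` in both
      -- `F` and `G`.
      λ e e′ eq → F∩G=∅ s (v (pick arbG e′))
        (subst (λ x → arcs F s (v x)) eq (pick-root-arc arbF e) , pick-root-arc arbG e′)

theorem10 : (k : ℕ) → 1 ≤ k → (H : Hypergraph) → Uniform k H → ¬ (∃ λ (c : TwoColoring H) → Proper H c) →
    Acyclic D[ H ]
    × (∀ x → x ∈ U[ H ] → λ[ D[ H ] ]⟨ s , x ⟩≡ k)
    × ¬ (∃₂ λ (F G : Subgraph D[ H ]) → IsArborescenceOn s U[ H ] F × IsArborescenceOn s U[ H ] G × ArcDisjoint F G)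
theorem10 k _ H uniform uncolourable =
  acyclic-D H ,
  (λ { _ (e , refl) → subst (λ[ D[ H ] ]⟨ s , u e ⟩≡_) (uniform e) (connectivity H e) }) ,
  (λ { (F , G , arbF , arbG , disj) →
         uncolourable (disjoint-arborescences⇒colourable H arbF arbG disj) })
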